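{- For every integer $n\ge 1$, $|\mathcal{S}_n(23;\,1\to 3)| = C_n$, where $C_n=\frac{1}{n+1}\binom{2n}{n}$ is the $n$-th Catalan number.
   Context: $[n]=\{1,\dots,n\}$, and $\mathcal{S}_n$ is the set of permutations $\pi=\pi_1\pi_2\cdots\pi_n$ of $[n]$ in one-line notation. The permutation $\hat\pi$: for $\pi\in\mathcal{S}_n$, $\hat\pi\in\mathcal{S}_n$ is the permutation whose cycle form is obtained from the word $\pi_1\cdots\pi_n$ by inserting a left parenthesis before each left-to-right maximum (an entry larger than all entries to its left) and a right parenthesis immediately before the next left-to-right maximum, or at the end of the word. A cycle $(c_1,c_2,\dots,c_s)$ means $c_1\mapsto c_2\mapsto\cdots\mapsto c_s\mapsto c_1$. Example: if $\pi=2537164$ then $\hat\pi=(2)(53)(7164)$. Arrow patterns: an arrow pattern of size $k$ is a pair $(\nu;H)$ where $\nu=\nu_1\cdots\nu_m$ is a word of distinct positive integers, $H$ is a collection of arrows $b_i\to c_i$, and the set of all integers appearing in $\nu$ or $H$ is $[k]$. A permutation $\pi\in\mathcal{S}_n$ contains $(\nu;H)$ if there are a set $X=\{x_1<x_2<\cdots<x_k\}\subseteq[n]$ and indices $t_1<\cdots<t_m$ such that $\pi_{t_1}\pi_{t_2}\cdots\pi_{t_m}=x_{\nu_1}x_{\nu_2}\cdots x_{\nu_m}$ and $\hat\pi(x_{b_i})=x_{c_i}$ for every arrow $b_i\to c_i$ in $H$. Otherwise $\pi$ avoids $(\nu;H)$. $\mathcal{S}_n(\nu;H)$ is the set of permutations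 in $\mathcal{S}_n$ avoiding $(\nu;H)$. -}

module Defs where

open import Data.Fin using (Fin; _<_; _<?_; _≟_)
open import Data.Fin.Patterns using (0F; 1F; 2F)
open import Data.Fin.Permutation using (Permutation′; _⟨$⟩ʳ_)
open import Data.List using (List; []; _∷_; foldr; tabulate)
open import Data.List.Relation.Unary.All using (All; all?)
open import Data.List.Relation.Unary.Any using (Any; here)
open import Data.Nat using (ℕ; suc; _*_; _/_)
open import Data.Nat.Combinatorics using (_C_)
open import Data.Product using (Σ; ∃; ∃-syntax; _×_; _,_; proj₁; proj₂)
open import Data.Sum using (_⊎_; inj₁; inj₂)
open import Data.Vec using (Vec; []; _∷_; lookup)
open import Data.Vec.Relation.Unary.All using ([]; _∷_)
open import Data.Vec.Relation.Unary.AllPairs using ([]; _∷_)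
open import Data.Vec.Relation.Unary.Unique.Propositional using (Unique)
open import Function using (id; _∘_)
open import Level using (0ℓ)
open import Relation.Binary using (Setoid; _Preserves_⟶_)
open import Relation.Binary.PropositionalEquality using (_≡_; refl; _→-setoid_)
open import Relation.Nullary using (¬_; yes; no)
import Relation.Binary.Construct.On as On

-- Fin n plays the role of [n] throughout, with i : Fin n standing for the
-- integer toℕ i + 1; only the order of the entries matters.

word : ∀ {n} → Permutation′ n → List (Fin n)
word π = tabulate (π ⟨$⟩ʳ_)

-- `cut left w` cuts w before each entry exceeding everything to its left, where
-- `left` holds the entries preceding w.  It returns the part of w before the
-- first such entry, and then the blocks, each starting with such an entry.
cut : ∀ {n} → List (Fin n) → List (Fin n) → List (Fin n) × List (List (Fin n))
cut left [] = [] , []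
cut left (x ∷ xs) with all? (_<? x) left | cut (x ∷ left) xs
... | yes _ | b , bs = [] , (x ∷ b) ∷ bs
... | no  _ | b , bs = x ∷ b , bs

-- The first component is empty here: the first letter of a word is always a
-- left-to-right maximum.
cycles : ∀ {n} → List (Fin n) → List (List (Fin n))
cycles w = proj₂ (cut [] w)

-- Finds the first occurrence of x in c ∷ cs and returns the entry following it,
-- or c₁ when x is the last entry, or x itself when there is no occurrence.
successor : ∀ {n} → Fin n → Fin n → List (Fin n) → Fin n → Fin n
successor c₁ c [] x with c ≟ x
... | yes _ = c₁
... | no  _ = x
successor c₁ c (d ∷ ds) x with c ≟ x
... | yes _ = d
... | no  _ = successor c₁ d ds x

-- The map c₁ ↦ c₂ ↦ ⋯ ↦ cₛ ↦ c₁ (for distinct cᵢ), fixing all other points.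
cycle : ∀ {n} → List (Fin n) → Fin n → Fin n
cycle []        x = x
cycle (c₁ ∷ cs) x = successor c₁ c₁ cs x

-- The cycles of a permutation word are disjoint, so the order of composition is
-- immaterial.
hat : ∀ {n} → Permutation′ n → Fin n → Fin n
hat π = foldr (λ c f → cycle c ∘ f) id (cycles (word π))

record ArrowPattern (k : ℕ) : Set where
  field
    {m}      : ℕ
    ν        : Vec (Fin k) m
    H        : List (Fin k × Fin k)
    distinct : Unique ν
    covers   : ∀ a → (∃[ i ] lookup ν i ≡ a) ⊎ Any (λ (b , c) → b ≡ a ⊎ c ≡ a) H

Contains : ∀ {n k} → Permutation′ n → ArrowPattern k → Set
Contains {n} {k} π p =
  Σ (Fin k → Fin n) λ x → Σ (Fin m → Fin n) λ t →
    x Preserves _<_ ⟶ _<_ ×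
    t Preserves _<_ ⟶ _<_ ×
    (∀ i → π ⟨$⟩ʳ t i ≡ x (lookup ν i)) ×
    All (λ (b , c) → hat π (x b) ≡ x c) H
  where open ArrowPattern p

Avoids : ∀ {n k} → Permutation′ n → ArrowPattern k → Set
Avoids π p = ¬ Contains π p

-- Two avoiders are equal when they agree as functions, regardless of the
-- evidence of invertibility or avoidance they carry.
𝒮 : ∀ {k} → ℕ → ArrowPattern k → Setoid 0ℓ 0ℓ
𝒮 n p = On.setoid {B = ∃ λ (π : Permutation′ n) → Avoids π p}
  (Fin n →-setoid Fin n) (λ (π , _) → π ⟨$⟩ʳ_)

-- The arrow pattern (23; 1 → 3), with letters shifted down by one.
pattern-23-1→3 : ArrowPattern 3
pattern-23-1→3 = record
  { ν        = 1F ∷ 2F ∷ []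
  ; H        = (0F , 2F) ∷ []
  ; distinct = ((λ ()) ∷ []) ∷ [] ∷ []
  ; covers   = λ { 0F → inj₂ (here (inj₁ refl))
                 ; 1F → inj₁ (0F , refl)
                 ; 2F → inj₁ (1F , refl) }
  }

-- The binomial coefficient is a multiple of n + 1, so the division is exact.
catalan : ℕ → ℕ
catalan n = ((2 * n) C n) / suc n

{-# OPTIONS --safe #-}

-- An arrow a → c of the cycle form with a < c is either an ascent a c inside a
-- block, or leads from the last letter a of a block back to its maximum c.  Hence π
-- avoids (23; 1 → 3) iff every block lies above the earlier ones and no ascent
-- inside a block jumps over an earlier letter, a condition inherited by prefixes.
-- A letter appended to an avoider with last letter a is admissible iff it is a new
-- maximum, or its rank is at least the number of letters before the last block and
-- at most a + 1.  Counting admissible letters gives the Catalan tree, in which the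
-- children of a node with d + 1 children have 2, 3, …, d + 2 children; its levels
-- are enumerated by ballot numbers.
module Submission where

open import Defs
open import Data.Empty using (⊥-elim)
open import Data.Fin using (Fin; zero; suc; toℕ; inject₁; fromℕ; fromℕ<; punchIn; _<_; _≤_; _>_; _<?_; _≟_)
open import Data.Fin.Induction using (>-wellFounded)
open import Data.Fin.Patterns using (0F; 1F; 2F)
open import Data.Fin.Permutation using (Permutation′; _⟨$⟩ʳ_; _⟨$⟩ˡ_; inverseʳ; inverseˡ; remove; insert; insert-punchIn; punchIn-permute) renaming (id to idₚ)
open import Data.Fin.Properties using (+↔⊎; all?; any?; toℕ-inject₁; toℕ-fromℕ; toℕ-fromℕ<; toℕ-injective; toℕ<n; ≤fromℕ; suc-injective; punchIn-injective; punchIn-mono-≤; punchIn-cancel-≤; <-cmp)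
import Data.Fin.Properties as Fin
open import Data.Fin.Relation.Unary.Top using (view; ‵fromℕ; ‵inject₁)
open import Data.List using (List; []; _∷_; _++_; concat; foldr; tabulate)
open import Data.List.Membership.Propositional using (_∈_; _∉_)
open import Data.List.Membership.Propositional.Properties using (∈-++⁺ˡ; ∈-++⁺ʳ)
open import Data.List.Relation.Unary.All as All using (All; []; _∷_)
import Data.List.Relation.Unary.All.Properties as All
open import Data.List.Relation.Unary.AllPairs using ([]; _∷_)
open import Data.List.Relation.Unary.Any using (Any; here; there)
open import Data.List.Relation.Unary.Unique.Propositional using (Unique)
open import Data.List.Relation.Unary.Unique.Propositional.Properties using (tabulate⁺)
open import Data.Nat as ℕ using (ℕ; zero; suc; _+_; _*_; _∸_; _/_; _≥_; z≤n; s≤s; z<s; s<s)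
open import Data.Nat.Combinatorics using (_C_; nCk+nC[k+1]≡[n+1]C[k+1]; nCk≡nC[n∸k])
open import Data.Nat.DivMod using (m*n/n≡m)
open import Data.Nat.Properties using (+-assoc; +-comm; +-suc; +-identityʳ; +-cancelʳ-≡; *-zeroʳ; m≤m+n; m+n∸m≡n)
import Data.Nat.Properties as ℕ
open import Algebra.Properties.Monoid.Sum ℕ.+-0-monoid using (sum; sum-init-last; sum-cong-≗)
open import Data.Nat.Tactic.RingSolver using (solve-∀)
open import Data.Product using (Σ; ∃-syntax; _×_; _,_; proj₁; proj₂)
open import Data.Product.Function.Dependent.Propositional using (congˡ)
open import Data.Sum using (_⊎_; inj₁; inj₂)
open import Data.Sum.Function.Propositional using (_⊎-↔_)
open import Function using (_∘_; id; _↔_; mk↔ₛ′)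
open import Function.Bundles using (Inverse)
open import Function.Construct.Composition using (inverse)
open import Function.Properties.Inverse using (↔-trans; ↔-sym; ↔-refl)
open import Induction.WellFounded using (Acc; acc)
open import Relation.Binary using (tri<; tri≈; tri>)
open import Relation.Binary.PropositionalEquality using (_≡_; _≢_; _≗_; refl; sym; trans; cong; cong₂; subst; subst₂; setoid; module ≡-Reasoning)
open import Relation.Nullary using (¬_; Dec; yes; no; contradiction)
open import Relation.Nullary.Decidable using (map′; _→-dec_; _×-dec_; ¬?; decidable-stable)

private variable
  m n : ℕ
  A : Set
  h x y z : A
  xs ys : List A

-- Ballot numbers and the Catalan tree

-- The number of paths of length k down the Catalan tree from a node with d + 1
-- children.
extensions : ℕ → ℕ → ℕ
extensions zero    d = 1
extensions (suc k) d = sum {suc d} λ j → extensions k (suc (toℕ j))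

-- Splitting off the last child: raising `d` by one adds a single child, whose parameter is `2 + d`.
extensions-suc : ∀ k d → extensions (suc k) (suc d) ≡ extensions (suc k) d + extensions k (2 + d)
extensions-suc k d = trans
  (sum-init-last {suc d} λ j → extensions k (suc (toℕ j)))
  (cong₂ _+_
    (sum-cong-≗ λ (j : Fin (suc d)) → cong (extensions k ∘ suc) (toℕ-inject₁ j))
    (cong (extensions k ∘ suc) (toℕ-fromℕ (suc d))))

infixl 6.5 _C⁻_
-- The binomial coefficient of `n` over `k - 1`, with value 0 at `k = 0`, where truncated
-- subtraction would give 1.
_C⁻_ : ℕ → ℕ → ℕ
n C⁻ zero  = 0
n C⁻ suc k = n C k

pascal : ∀ n k → n C⁻ k + n C k ≡ suc n C k
pascal n zero    = refl
pascal n (suc k) = nCk+nC[k+1]≡[n+1]C[k+1] n k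

centre : ∀ k → suc (2 * k) C suc k ≡ suc (2 * k) C k
centre k = trans
  (nCk≡nC[n∸k] (s≤s (m≤m+n k _)))
  (cong (suc (2 * k) C_) (trans (m+n∸m≡n k (k + 0)) (+-identityʳ k)))

-- The ballot number as a difference of binomial coefficients, with the subtracted term moved
-- across. By Pascal's rule both coefficients obey the recurrence of `extensions-suc`; at `d = 0`
-- the symmetry `centre` closes the argument. The induction is lexicographic, since `d` may grow
-- when `k` drops.
extensions-closed : ∀ k d → extensions k d + (2 * k + d) C⁻ k ≡ (2 * k + d) C k
extensions-closed zero    d       = refl
extensions-closed (suc k) zero    = begin
  (e + 0) + (2 * suc k + 0) C k
    ≡⟨ cong₂ (λ x N → x + N C k) (+-identityʳ e) (size k) ⟩
  e + suc N C k
    ≡⟨ cong (e +_) (sym (pascal N k)) ⟩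
  e + (N C⁻ k + N C k)
    ≡⟨ sym (+-assoc e _ _) ⟩
  (e + N C⁻ k) + N C k
    ≡⟨ cong (_+ N C k) (subst (λ N → e + N C⁻ k ≡ N C k) (+-comm (2 * k) 1) (extensions-closed k 1)) ⟩
  N C k + N C k
    ≡⟨ cong (N C k +_) (sym (centre k)) ⟩
  N C k + N C suc k
    ≡⟨ pascal N (suc k) ⟩
  suc N C suc k
    ≡⟨ cong (_C suc k) (sym (size k)) ⟩
  (2 * suc k + 0) C suc k ∎
  where
  open ≡-Reasoning
  e = extensions k 1
  N = suc (2 * k)
  size : ∀ k → 2 * suc k + 0 ≡ suc (suc (2 * k))
  size = solve-∀
extensions-closed (suc k) (suc d) = begin
  extensions (suc k) (suc d) + (2 * suc k + suc d) C k
    ≡⟨ cong₂ (λ x M → x + M C k) (extensions-suc k d) (+-suc (2 * suc k) d) ⟩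
  (e₁ + e₂) + suc N C k
    ≡⟨ cong ((e₁ + e₂) +_) (sym (pascal N k)) ⟩
  (e₁ + e₂) + (N C⁻ k + N C k)
    ≡⟨ shuffle e₁ e₂ (N C⁻ k) (N C k) ⟩
  (e₁ + N C k) + (e₂ + N C⁻ k)
    ≡⟨ cong₂ _+_ (extensions-closed (suc k) d)
         (subst (λ N → e₂ + N C⁻ k ≡ N C k) (size k d) (extensions-closed k (2 + d))) ⟩
  N C suc k + N C k
    ≡⟨ +-comm (N C suc k) (N C k) ⟩
  N C k + N C suc k
    ≡⟨ pascal N (suc k) ⟩
  suc N C suc k
    ≡⟨ cong (_C suc k) (sym (+-suc (2 * suc k) d)) ⟩
  (2 * suc k + suc d) C suc k ∎
  where
  open ≡-Reasoning
  e₁ = extensions (suc k) d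
  e₂ = extensions k (2 + d)
  N = 2 * suc k + d
  size : ∀ k d → 2 * k + (2 + d) ≡ 2 * suc k + d
  size = solve-∀
  shuffle : ∀ a b c d → (a + b) + (c + d) ≡ (a + d) + (b + c)
  shuffle = solve-∀

-- The identity `(k + 1) C(n, k + 1) = (n - k) C(n, k)` with the subtraction cleared, by induction
-- on `n` with Pascal's rule.
absorption : ∀ n k → suc k * (n C suc k) + k * (n C k) ≡ n * (n C k)
absorption zero    zero    = refl
absorption zero    (suc k) = cong₂ _+_ (*-zeroʳ (2 + k)) (*-zeroʳ (suc k))
absorption (suc n) zero    = begin
  1 * (suc n C 1) + 0 ≡⟨ cong (λ x → 1 * x + 0) (sym (pascal n 1)) ⟩
  1 * (1 + n C 1) + 0 ≡⟨ unfold (n C 1) ⟩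
  suc (1 * (n C 1) + 0 * 1) ≡⟨ cong suc (absorption n 0) ⟩
  suc (n * 1) ∎
  where
  open ≡-Reasoning
  unfold : ∀ x → 1 * (1 + x) + 0 ≡ suc (1 * x + 0 * 1)
  unfold = solve-∀
absorption (suc n) (suc k) = begin
  (2 + k) * (suc n C (2 + k)) + suc k * (suc n C suc k)
    ≡⟨ cong₂ (λ x y → (2 + k) * x + suc k * y) (sym (pascal n (2 + k))) (sym (pascal n (suc k))) ⟩
  (2 + k) * (b + c) + suc k * (a + b)
    ≡⟨ expand k a b c ⟩
  ((2 + k) * c + suc k * b) + (suc k * b + k * a) + (a + b)
    ≡⟨ cong₂ (λ x y → x + y + (a + b)) (absorption n (suc k)) (absorption n k) ⟩
  n * b + n * a + (a + b)
    ≡⟨ collect n a b ⟩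
  suc n * (a + b)
    ≡⟨ cong (suc n *_) (pascal n (suc k)) ⟩
  suc n * (suc n C suc k) ∎
  where
  open ≡-Reasoning
  a = n C k
  b = n C suc k
  c = n C (2 + k)
  expand : ∀ k a b c → (2 + k) * (b + c) + suc k * (a + b)
    ≡ ((2 + k) * c + suc k * b) + (suc k * b + k * a) + (a + b)
  expand = solve-∀
  collect : ∀ n a b → n * b + n * a + (a + b) ≡ suc n * (a + b)
  collect = solve-∀

-- For `n = suc m` this is `absorption` in row `2n` at column `m`, where `2n - m = m + 2`. It
-- converts the ballot difference into the quotient that defines `catalan`.
central-ratio : ∀ n → n * ((2 * n) C n) ≡ suc n * ((2 * n) C⁻ n)
central-ratio zero    = refl
central-ratio (suc m) = +-cancelʳ-≡ (m * (N C m)) _ _ (begin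
  suc m * (N C suc m) + m * (N C m) ≡⟨ absorption N m ⟩
  N * (N C m)                     ≡⟨ split m (N C m) ⟩
  (2 + m) * (N C m) + m * (N C m)   ∎)
  where
  open ≡-Reasoning
  N = 2 * suc m
  split : ∀ m x → 2 * suc m * x ≡ (2 + m) * x + m * x
  split = solve-∀

extensions≡catalan : ∀ n → extensions n 0 ≡ catalan n
extensions≡catalan n = sym (begin
  (N C n) / suc n               ≡⟨ cong (_/ suc n) (sym product) ⟩
  e * suc n / suc n             ≡⟨ m*n/n≡m e (suc n) ⟩
  e                             ∎)
  where
  open ≡-Reasoning
  N = 2 * n
  e = extensions n 0
  distribute : ∀ n e x → e * suc n + suc n * x ≡ n * (e + x) + (e + x)
  distribute = solve-∀
  closed : e + N C⁻ n ≡ N C n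
  closed = subst (λ N → e + N C⁻ n ≡ N C n) (+-identityʳ (2 * n)) (extensions-closed n 0)
  -- After adding `suc n * (N C⁻ n)`, the left side becomes `suc n * (N C n)`, from which
  -- `central-ratio` splits the same term off again.
  product : e * suc n ≡ N C n
  product = +-cancelʳ-≡ (suc n * (N C⁻ n)) _ _ (begin
    e * suc n + suc n * (N C⁻ n)          ≡⟨ distribute n e (N C⁻ n) ⟩
    n * (e + N C⁻ n) + (e + N C⁻ n)     ≡⟨ cong (λ x → n * x + x) closed ⟩
    n * (N C n) + N C n                   ≡⟨ cong (_+ N C n) (central-ratio n) ⟩
    suc n * (N C⁻ n) + N C n              ≡⟨ +-comm _ (N C n) ⟩
    N C n + suc n * (N C⁻ n)              ∎)

-- Counting codes

Σ-Fin↔Fin-sum : ∀ {n} (f : Fin n → ℕ) → Σ (Fin n) (Fin ∘ f) ↔ Fin (sum f)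
Σ-Fin↔Fin-sum {zero}  f = mk↔ₛ′ (λ { (() , _) }) (λ ()) (λ ()) (λ { (() , _) })
Σ-Fin↔Fin-sum {suc n} f =
  ↔-trans split (↔-trans (↔-refl ⊎-↔ Σ-Fin↔Fin-sum (f ∘ suc)) (↔-sym +↔⊎))
  where
  split : Σ (Fin (suc n)) (Fin ∘ f) ↔ (Fin (f zero) ⊎ Σ (Fin n) (Fin ∘ f ∘ suc))
  split = mk↔ₛ′
    (λ { (zero , x) → inj₁ x ; (suc i , x) → inj₂ (i , x) })
    (λ { (inj₁ x) → zero , x ; (inj₂ (i , x)) → suc i , x })
    (λ { (inj₁ x) → refl ; (inj₂ _) → refl })
    (λ { (zero , x) → refl ; (suc i , x) → refl })

-- A code stands for an avoider, to which suc (width c) different letters can be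
-- appended; c ▷ zero appends a new maximum.
mutual
  infixl 5 _▷_
  data Code : ℕ → Set where
    []  : Code 0
    _▷_ : ∀ {n} (c : Code n) → Fin (suc (width c)) → Code (suc n)

  width : ∀ {n} → Code n → ℕ
  width []      = 0
  width (c ▷ j) = suc (toℕ j)

-- A code followed by `k` further steps down the tree is a path of length `n + k` from the root. The
-- induction hands the last digit of the code over to the counted steps, so `k` grows as `n` drops.
extended-codes : ∀ n k → Σ (Code n) (λ c → Fin (extensions k (width c))) ↔ Fin (extensions (n + k) 0)
extended-codes zero    k = mk↔ₛ′ (λ { ([] , x) → x }) ([] ,_) (λ _ → refl) (λ { ([] , _) → refl })
extended-codes (suc n) k =
  ↔-trans unsnoc (↔-trans (congˡ λ {c} → Σ-Fin↔Fin-sum {suc (width c)} _)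
    (subst (λ m → Σ (Code n) (λ c → Fin (extensions (suc k) (width c))) ↔ Fin (extensions m 0))
      (+-suc n k) (extended-codes n (suc k))))
  where
  unsnoc : Σ (Code (suc n)) (λ c → Fin (extensions k (width c)))
    ↔ Σ (Code n) (λ c → Σ (Fin (suc (width c))) λ j → Fin (extensions k (suc (toℕ j))))
  unsnoc = mk↔ₛ′
    (λ { (c ▷ j , x) → c , j , x })
    (λ { (c , j , x) → c ▷ j , x })
    (λ _ → refl)
    (λ { (c ▷ j , x) → refl })

Code↔Fin-catalan : ∀ n → Code n ↔ Fin (catalan n)
Code↔Fin-catalan n = ↔-trans
  (mk↔ₛ′ (_, zero) proj₁ (λ { (_ , zero) → refl }) (λ _ → refl))
  (subst (λ m → Σ (Code n) (λ _ → Fin 1) ↔ Fin m)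
    (trans (cong (λ m → extensions m 0) (+-identityʳ n)) (extensions≡catalan n))
    (extended-codes n 0))

-- Codes and permutations

inject₁-mono-< : {i j : Fin n} → i < j → inject₁ i < inject₁ j
inject₁-mono-< = subst₂ ℕ._<_ (sym (toℕ-inject₁ _)) (sym (toℕ-inject₁ _))

inject₁-cancel-< : {i j : Fin n} → inject₁ i < inject₁ j → i < j
inject₁-cancel-< = subst₂ ℕ._<_ (toℕ-inject₁ _) (toℕ-inject₁ _)

inject₁<fromℕ : (i : Fin n) → inject₁ i < fromℕ n
inject₁<fromℕ {n} i = subst₂ ℕ._<_ (sym (toℕ-inject₁ i)) (sym (toℕ-fromℕ n)) (toℕ<n i)

fromℕ-maximum : {i : Fin (suc n)} → ¬ fromℕ n < i
fromℕ-maximum {i = i} = ℕ.≤⇒≯ (≤fromℕ i)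

<⇒inject₁ : {i j : Fin (suc n)} → i < j → ∃[ k ] i ≡ inject₁ k
<⇒inject₁ {i = i} i<j with view i
... | ‵fromℕ     = contradiction i<j fromℕ-maximum
... | ‵inject₁ k = k , refl

punchIn-fromℕ : (i : Fin n) → punchIn (fromℕ n) i ≡ inject₁ i
punchIn-fromℕ zero    = refl
punchIn-fromℕ (suc i) = cong suc (punchIn-fromℕ i)

punchIn-< : (e : Fin (suc n)) (v : Fin n) → toℕ v ℕ.< toℕ e → toℕ (punchIn e v) ≡ toℕ v
punchIn-< (suc e) zero    _         = refl
punchIn-< (suc e) (suc v) (s<s v<e) = cong suc (punchIn-< e v v<e)

punchIn-≥ : (e : Fin (suc n)) (v : Fin n) → toℕ e ℕ.≤ toℕ v → toℕ (punchIn e v) ≡ suc (toℕ v)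
punchIn-≥ zero    v       _         = refl
punchIn-≥ (suc e) (suc v) (s≤s e≤v) = cong suc (punchIn-≥ e v e≤v)

punchIn<⇒< : (e : Fin (suc n)) (v : Fin n) → punchIn e v < e → toℕ v ℕ.< toℕ e
punchIn<⇒< e v p<e with toℕ v ℕ.<? toℕ e
... | yes v<e = v<e
... | no  v≮e = contradiction
  (ℕ.<-trans (subst (ℕ._< toℕ e) (punchIn-≥ e v e≤v) p<e) (s≤s e≤v)) (ℕ.<-irrefl refl)
  where e≤v = ℕ.≮⇒≥ v≮e

-- Left-to-right maxima.
Record : (Fin m → Fin n) → Fin m → Set
Record f j = ∀ {i} → i < j → f i < f j

-- Every block lies above all earlier blocks, and no ascent inside a block jumps
-- over an earlier letter.
record Good (f : Fin m → Fin n) : Set where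
  field
    blocks  : ∀ {i j k} → i < j → j < k → Record f j → f i < f k
    ascents : ∀ {i j k} → i < j → toℕ k ≡ suc (toℕ j) → f j < f i → f i < f k → Record f k
open Good

-- A relation between words rather than an operation on permutations, so that the same lemmas serve
-- `insert`, which builds a word, and `remove`, which takes it apart.
record Appends (g : Fin n → Fin n) (e : Fin (suc n)) (f : Fin (suc n) → Fin (suc n)) : Set where
  field
    init  : ∀ i → f (inject₁ i) ≡ punchIn e (g i)
    final : f (fromℕ n) ≡ e

  mono : ∀ {i j} → g i < g j → f (inject₁ i) < f (inject₁ j)
  mono {i} {j} gi<gj = ℕ.≰⇒> λ fj≤fi → ℕ.<⇒≱ gi<gj
    (punchIn-cancel-≤ e (g j) (g i) (subst₂ (λ x y → toℕ x ℕ.≤ toℕ y) (init j) (init i) fj≤fi))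

  cancel : ∀ {i j} → f (inject₁ i) < f (inject₁ j) → g i < g j
  cancel {i} {j} fi<fj = ℕ.≰⇒> λ gj≤gi → ℕ.<⇒≱ fi<fj
    (subst₂ (λ x y → toℕ x ℕ.≤ toℕ y) (sym (init j)) (sym (init i)) (punchIn-mono-≤ e (g j) (g i) gj≤gi))

  init-< : ∀ {i} → toℕ (g i) ℕ.< toℕ e → toℕ (f (inject₁ i)) ≡ toℕ (g i)
  init-< {i} gi<e = trans (cong toℕ (init i)) (punchIn-< e (g i) gi<e)

  init<e : ∀ {i} → toℕ (g i) ℕ.< toℕ e → f (inject₁ i) < f (fromℕ n)
  init<e gi<e = subst₂ ℕ._<_ (sym (init-< gi<e)) (cong toℕ (sym final)) gi<e

  init<e⁻ : ∀ {i} → f (inject₁ i) < f (fromℕ n) → toℕ (g i) ℕ.< toℕ e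
  init<e⁻ {i} fi<e = punchIn<⇒< e (g i) (subst₂ _<_ (init i) final fi<e)

  Record⁺ : ∀ {j} → Record g j → Record f (inject₁ j)
  Record⁺ rec i<j with <⇒inject₁ i<j
  ... | _ , refl = mono (rec (inject₁-cancel-< i<j))

  Record⁻ : ∀ {j} → Record f (inject₁ j) → Record g j
  Record⁻ rec i<j = cancel (rec (inject₁-mono-< i<j))

  Record-last : toℕ e ≡ n → Record f (fromℕ n)
  Record-last e≡n i<last with <⇒inject₁ i<last
  ... | i , refl = init<e (subst (toℕ (g i) ℕ.<_) (sym e≡n) (toℕ<n (g i)))

  Good⁻ : Good f → Good g
  Good⁻ good .blocks i<j j<k rec =
    cancel (blocks good (inject₁-mono-< i<j) (inject₁-mono-< j<k) (Record⁺ rec))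
  Good⁻ good .ascents {k = k} i<j k≡1+j gj<gi gi<gk = Record⁻
    (ascents good (inject₁-mono-< i<j)
      (trans (toℕ-inject₁ k) (trans k≡1+j (cong suc (sym (toℕ-inject₁ _)))))
      (mono gj<gi) (mono gi<gk))

  -- The two hypotheses are the instances of `blocks` and `ascents` with `k` the new last position;
  -- all other instances are inherited from `g`, because `i < j < k`.
  Good⁺ : Good g →
    (∀ {i j} → i < j → Record g j → toℕ (g i) ℕ.< toℕ e) →
    (∀ {i j} → i < j → n ≡ suc (toℕ j) → g j < g i → toℕ (g i) ℕ.< toℕ e → toℕ e ≡ n) →
    Good f
  Good⁺ good above-blocks short-ascent .blocks {k = k} i<j j<k rec
    with <⇒inject₁ i<j | <⇒inject₁ j<k | view k
  ... | _ , refl | _ , refl | ‵fromℕ     = init<e (above-blocks (inject₁-cancel-< i<j) (Record⁻ rec))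
  ... | _ , refl | _ , refl | ‵inject₁ _ =
    mono (blocks good (inject₁-cancel-< i<j) (inject₁-cancel-< j<k) (Record⁻ rec))
  Good⁺ good above-blocks short-ascent .ascents {k = k} i<j k≡1+j fj<fi fi<fk
    with <⇒inject₁ i<j | <⇒inject₁ (ℕ.≤-reflexive (sym k≡1+j)) | view k
  ... | _ , refl | j , refl | ‵fromℕ     = Record-last (short-ascent (inject₁-cancel-< i<j)
    (trans (sym (toℕ-fromℕ n)) (trans k≡1+j (cong suc (toℕ-inject₁ j))))
    (cancel fj<fi) (init<e⁻ fi<fk))
  ... | _ , refl | j , refl | ‵inject₁ k = Record⁺ (ascents good (inject₁-cancel-< i<j)
    (trans (sym (toℕ-inject₁ k)) (trans k≡1+j (cong suc (toℕ-inject₁ j))))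
    (cancel fj<fi) (cancel fi<fk))

Appends-cong : ∀ {g g′ : Fin n → Fin n} {e e′ f f′} → Appends g e f → Appends g′ e′ f′ →
  g ≗ g′ → e ≡ e′ → f ≗ f′
Appends-cong a a′ g≗g′ refl i with view i
... | ‵fromℕ     = trans (Appends.final a) (sym (Appends.final a′))
... | ‵inject₁ i = trans (Appends.init a i) (trans (cong (punchIn _) (g≗g′ i)) (sym (Appends.init a′ i)))

insert-self : ∀ i (j : Fin (suc n)) (π : Permutation′ n) → insert i j π ⟨$⟩ʳ i ≡ j
insert-self i j π with i ≟ i
... | yes _   = refl
... | no  i≢i = contradiction refl i≢i

insert-appends : ∀ e (π : Permutation′ n) → Appends (π ⟨$⟩ʳ_) e (insert (fromℕ n) e π ⟨$⟩ʳ_)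
insert-appends {n} e π = record
  { init  = λ i → trans (cong (insert (fromℕ n) e π ⟨$⟩ʳ_) (sym (punchIn-fromℕ i)))
                        (insert-punchIn (fromℕ n) e π i)
  ; final = insert-self (fromℕ n) e π
  }

remove-appends : (π : Permutation′ (suc n)) →
  Appends (remove (fromℕ n) π ⟨$⟩ʳ_) (π ⟨$⟩ʳ fromℕ n) (π ⟨$⟩ʳ_)
remove-appends {n} π = record
  { init  = λ i → trans (cong (π ⟨$⟩ʳ_) (sym (punchIn-fromℕ i))) (punchIn-permute π (fromℕ n) i)
  ; final = refl
  }

-- The number of letters before the last block.  The admissible letters are the
-- width c values from base c on, together with the new maximum.
base : Code n → ℕ
base []                = 0
base (_▷_ {n} c zero)  = n
base (c ▷ suc j)       = base c

base+width≤n : (c : Code n) → base c + width c ℕ.≤ n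
base+width≤n []              = z≤n
base+width≤n (_▷_ {n} c zero) = ℕ.≤-reflexive (ℕ.+-comm n 1)
base+width≤n (_▷_ {n} c (suc j)) = begin
  base c + suc (suc (toℕ j)) ≤⟨ ℕ.+-monoʳ-≤ (base c) (s≤s (toℕ<n j)) ⟩
  base c + suc (width c)     ≡⟨ ℕ.+-suc (base c) (width c) ⟩
  suc (base c + width c)     ≤⟨ s≤s (base+width≤n c) ⟩
  suc n                      ∎
  where open ℕ.≤-Reasoning

base+j<n : (c : Code n) (j : Fin (width c)) → base c + toℕ j ℕ.< n
base+j<n c j = ℕ.<-≤-trans (ℕ.+-monoʳ-< (base c) (toℕ<n j)) (base+width≤n c)

letter : (c : Code n) → Fin (suc (width c)) → Fin (suc n)
letter {n} c zero = fromℕ n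
letter c (suc j)  = inject₁ (fromℕ< (base+j<n c j))

toℕ-letter : (c : Code n) (j : Fin (width c)) → toℕ (letter c (suc j)) ≡ base c + toℕ j
toℕ-letter c j = trans (toℕ-inject₁ _) (toℕ-fromℕ< (base+j<n c j))

base≤letter : (c : Code n) (j : Fin (width c)) → base c ℕ.≤ toℕ (letter c (suc j))
base≤letter c j = subst (base c ℕ.≤_) (sym (toℕ-letter c j)) (ℕ.m≤m+n (base c) (toℕ j))

letter<n : (c : Code n) (j : Fin (width c)) → toℕ (letter c (suc j)) ℕ.< n
letter<n {n} c j = subst (ℕ._< n) (sym (toℕ-letter c j)) (base+j<n c j)

letter-injective : (c : Code n) {i j : Fin (suc (width c))} → letter c i ≡ letter c j → i ≡ j
letter-injective     c {zero}  {zero}  _  = refl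
letter-injective {n} c {zero}  {suc j} eq =
  contradiction (trans (cong toℕ (sym eq)) (toℕ-fromℕ n)) (ℕ.<⇒≢ (letter<n c j))
letter-injective {n} c {suc i} {zero}  eq =
  contradiction (trans (cong toℕ eq) (toℕ-fromℕ n)) (ℕ.<⇒≢ (letter<n c i))
letter-injective     c {suc i} {suc j} eq = cong suc (toℕ-injective (ℕ.+-cancelˡ-≡ (base c) _ _
  (trans (sym (toℕ-letter c i)) (trans (cong toℕ eq) (toℕ-letter c j)))))

-- Good permutations and their codes

perm : Code n → Permutation′ n
perm []              = idₚ
perm (_▷_ {n} c j)   = insert (fromℕ n) (letter c j) (perm c)

perm-appends : (c : Code n) (j : Fin (suc (width c))) →
  Appends (perm c ⟨$⟩ʳ_) (letter c j) (perm (c ▷ j) ⟨$⟩ʳ_)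
perm-appends c j = insert-appends (letter c j) (perm c)

perm-injective : (c c′ : Code n) → (perm c ⟨$⟩ʳ_) ≗ (perm c′ ⟨$⟩ʳ_) → c ≡ c′
perm-injective []      []        _  = refl
perm-injective (c ▷ j) (c′ ▷ j′) eq = conclude same-init same-final
  where
  module L = Appends (perm-appends c j)
  module R = Appends (perm-appends c′ j′)
  same-final : letter c j ≡ letter c′ j′
  same-final = trans (sym L.final) (trans (eq _) R.final)
  same-init : c ≡ c′
  same-init = perm-injective c c′ λ i → punchIn-injective (letter c j) _ _
    (trans (sym (L.init i)) (trans (eq (inject₁ i))
      (trans (R.init i) (cong (λ e → punchIn e (perm c′ ⟨$⟩ʳ i)) (sym same-final)))))
  conclude : c ≡ c′ → letter c j ≡ letter c′ j′ → c ▷ j ≡ c′ ▷ j′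
  conclude refl eq = cong (c ▷_) (letter-injective c eq)

-- By surjectivity some old letter has value `e < n`; appending `e` raises it to `e + 1`, so it
-- stays above the new last letter.
last-not-record : (π : Permutation′ n) {e : Fin (suc n)} {f : Fin (suc n) → Fin (suc n)} →
  Appends (π ⟨$⟩ʳ_) e f → toℕ e ℕ.< n → ¬ Record f (fromℕ n)
last-not-record {n} π {e} {f} a e<n rec = ℕ.<⇒≱ (init<e⁻ (rec (inject₁<fromℕ i))) e≤πi
  where
  open Appends a
  i = π ⟨$⟩ˡ fromℕ< e<n
  e≤πi : toℕ e ℕ.≤ toℕ (π ⟨$⟩ʳ i)
  e≤πi = ℕ.≤-reflexive (sym (trans (cong toℕ (inverseʳ π)) (toℕ-fromℕ< e<n)))

-- With its converse `below-base⁻`, this identifies the letters before the last block, namely those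
-- with a record after them, as the values smaller than `base c`. An appended maximum puts all old
-- letters before the last block; any other admissible letter is at least `base c`, so it is no
-- record and shifts no value below `base c`.
below-base : (c : Code n) → ∀ {i j} → i < j → Record (perm c ⟨$⟩ʳ_) j → toℕ (perm c ⟨$⟩ʳ i) ℕ.< base c
below-base {suc n} (c ▷ zero) i<j rec with <⇒inject₁ i<j
... | i , refl = subst (ℕ._< n) (sym (init-< small)) (toℕ<n (perm c ⟨$⟩ʳ i))
  where
  open Appends (perm-appends c zero)
  small = subst (toℕ (perm c ⟨$⟩ʳ i) ℕ.<_) (sym (toℕ-fromℕ n)) (toℕ<n (perm c ⟨$⟩ʳ i))
below-base (c ▷ suc l) {j = j} i<j rec with <⇒inject₁ i<j | view j
... | i , refl | ‵fromℕ     = ⊥-elim (last-not-record (perm c) (perm-appends c (suc l)) (letter<n c l) rec)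
... | i , refl | ‵inject₁ j = subst (ℕ._< base c) (sym (init-< (ℕ.<-≤-trans below (base≤letter c l)))) below
  where
  open Appends (perm-appends c (suc l))
  below = below-base c (inject₁-cancel-< i<j) (Record⁻ rec)

below-base⁻ : (c : Code n) → ∀ {i} → toℕ (perm c ⟨$⟩ʳ i) ℕ.< base c → ∃[ j ] i < j × Record (perm c ⟨$⟩ʳ_) j
below-base⁻ {suc n} (c ▷ zero) {i} below with view i
... | ‵fromℕ     = contradiction (trans (cong toℕ final) (toℕ-fromℕ n)) (ℕ.<⇒≢ below)
  where open Appends (perm-appends c zero)
... | ‵inject₁ i = fromℕ n , inject₁<fromℕ i , Record-last (toℕ-fromℕ n)
  where open Appends (perm-appends c zero)
below-base⁻ {suc n} (c ▷ suc l) {i} below with view i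
... | ‵fromℕ     = contradiction (base≤letter c l) (ℕ.<⇒≱ (subst (ℕ._< base c) (cong toℕ final) below))
  where open Appends (perm-appends c (suc l))
... | ‵inject₁ i = conclude (below-base⁻ c (subst (ℕ._< base c) (init-< small) below))
  where
  open Appends (perm-appends c (suc l))
  small : toℕ (perm c ⟨$⟩ʳ i) ℕ.< toℕ (letter c (suc l))
  small = init<e⁻ (subst (toℕ (perm (c ▷ suc l) ⟨$⟩ʳ inject₁ i) ℕ.<_) (cong toℕ (sym final)) (ℕ.<-≤-trans below (base≤letter c l)))
  conclude : ∃[ j ] i < j × Record (perm c ⟨$⟩ʳ_) j → ∃[ j ] inject₁ i < j × Record (perm (c ▷ suc l) ⟨$⟩ʳ_) j
  conclude (j , i<j , rec) = inject₁ j , inject₁-mono-< i<j , Record⁺ rec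

-- The admissible letters other than the new maximum run from `base c` to `a + 1`, whence the bound
-- `2 + a`. If `a` is itself the maximum, then `a + 1` is the new maximum, which is counted apart,
-- and the bound drops by one.
base+width : (c : Code (suc n)) → let a = toℕ (perm c ⟨$⟩ʳ fromℕ n) in
  base c + width c ≡ 2 + a ⊎ base c + width c ≡ suc n × a ≡ n
base+width {n} (c ▷ zero)  = inj₂ (ℕ.+-comm n 1 , trans (cong toℕ final) (toℕ-fromℕ n))
  where open Appends (perm-appends c zero)
base+width {n} (c ▷ suc l) = inj₁ (begin
  base c + (2 + toℕ l)   ≡⟨ ℕ.+-suc (base c) (suc (toℕ l)) ⟩
  suc (base c + suc (toℕ l)) ≡⟨ cong suc (ℕ.+-suc (base c) (toℕ l)) ⟩
  2 + (base c + toℕ l)   ≡⟨ cong (2 +_) (sym (trans (cong toℕ final) (toℕ-letter c l))) ⟩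
  2 + toℕ (perm (c ▷ suc l) ⟨$⟩ʳ fromℕ n) ∎)
  where
  open Appends (perm-appends c (suc l))
  open ≡-Reasoning

letter≤1+last : (c : Code (suc n)) (l : Fin (width c)) →
  toℕ (letter c (suc l)) ℕ.≤ suc (toℕ (perm c ⟨$⟩ʳ fromℕ n))
letter≤1+last {n} c l with base+width c
... | inj₁ eq        = subst (ℕ._≤ _) (sym (toℕ-letter c l))
  (ℕ.≤-pred (subst (base c + toℕ l ℕ.<_) eq (ℕ.+-monoʳ-< (base c) (toℕ<n l))))
... | inj₂ (_ , a≡n) = ℕ.<⇒≤ (subst (toℕ (letter c (suc l)) ℕ.<_) (cong suc (sym a≡n)) (letter<n c l))

perm-good : (c : Code n) → Good (perm c ⟨$⟩ʳ_)
perm-good []                    = record { blocks = λ { {()} } ; ascents = λ { {()} } }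
perm-good (_▷_ {n} c zero)      = Good⁺ (perm-good c)
  (λ {i} _ _ → subst (toℕ (perm c ⟨$⟩ʳ i) ℕ.<_) (sym (toℕ-fromℕ n)) (toℕ<n (perm c ⟨$⟩ʳ i)))
  (λ _ _ _ _ → toℕ-fromℕ n)
  where open Appends (perm-appends c zero)
perm-good (_▷_ {zero}  c (suc l)) = Good⁺ (perm-good c) (λ { {()} }) (λ { {()} })
  where open Appends (perm-appends c (suc l))
perm-good (_▷_ {suc n} c (suc l)) = Good⁺ (perm-good c)
  (λ i<j rec → ℕ.<-≤-trans (below-base c i<j rec) (base≤letter c l))
  -- With `a` the last letter of `perm c` and `e` the appended one, an earlier letter that is jumped
  -- over would lie strictly between `a` and `e ≤ a + 1`.
  λ {i} {j} _ n≡1+j gj<gi gi<e → contradiction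
    (ℕ.≤-trans gi<e (letter≤1+last c l))
    (ℕ.<⇒≱ (s≤s (subst (λ j → perm c ⟨$⟩ʳ j < perm c ⟨$⟩ʳ i)
      (toℕ-injective (trans (sym (ℕ.suc-injective n≡1+j)) (sym (toℕ-fromℕ n)))) gj<gi)))
  where open Appends (perm-appends c (suc l))

-- If `e < base c`, the old letter of value `e` has a record after it, and appending `e` raises it
-- above the new letter, against `blocks`.
base≤final : (c : Code n) → ∀ {e f} → Appends (perm c ⟨$⟩ʳ_) e f → Good f → toℕ e ℕ.< n →
  base c ℕ.≤ toℕ e
base≤final c {e} a good e<n = ℕ.≮⇒≥ λ e<base →
  let i = perm c ⟨$⟩ˡ fromℕ< e<n
      πi≡e = trans (cong toℕ (inverseʳ (perm c))) (toℕ-fromℕ< e<n)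
      j , i<j , rec = below-base⁻ c (subst (ℕ._< base c) (sym πi≡e) e<base)
  in ℕ.<-irrefl πi≡e (init<e⁻ (blocks good (inject₁-mono-< i<j) (inject₁<fromℕ j) (Record⁺ rec)))
  where open Appends a

-- Let `a` be the last letter of `perm c`. If `e ≥ 2 + a`, the step from `a` to `e` jumps over the
-- earlier letter `a + 1`, so `ascents` makes the last position a record, against `last-not-record`.
-- If the bound is instead the length of the code, `e` lies below it by assumption.
final<base+width : (c : Code n) → ∀ {e f} → Appends (perm c ⟨$⟩ʳ_) e f → Good f → toℕ e ℕ.< n →
  toℕ e ℕ.< base c + width c
final<base+width {suc n} c {e} {f} a good e<n = ℕ.≰⇒> λ top≤e → too-large top≤e (base+width c)
  where
  open Appends a
  π = perm c
  α = toℕ (π ⟨$⟩ʳ fromℕ n)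
  too-large : base c + width c ℕ.≤ toℕ e → ¬ (base c + width c ≡ 2 + α ⊎ base c + width c ≡ suc n × α ≡ n)
  too-large top≤e (inj₂ (eq , _)) = ℕ.<⇒≱ e<n (subst (ℕ._≤ toℕ e) eq top≤e)
  too-large top≤e (inj₁ eq) = last-not-record π a e<n
    (ascents good (inject₁-mono-< i<last)
      (trans (toℕ-fromℕ (suc n)) (cong suc (sym (trans (toℕ-inject₁ (fromℕ n)) (toℕ-fromℕ n)))))
      (mono (subst (α ℕ.<_) (sym πi≡1+α) ℕ.≤-refl))
      (init<e (subst (ℕ._< toℕ e) (sym πi≡1+α) 1+α<e)))
    where
    1+α<e : suc α ℕ.< toℕ e
    1+α<e = subst (ℕ._≤ toℕ e) eq top≤e
    i = π ⟨$⟩ˡ fromℕ< (ℕ.<-trans 1+α<e e<n)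
    πi≡1+α : toℕ (π ⟨$⟩ʳ i) ≡ suc α
    πi≡1+α = trans (cong toℕ (inverseʳ π)) (toℕ-fromℕ< (ℕ.<-trans 1+α<e e<n))
    i<last : i < fromℕ n
    i<last = ℕ.≤∧≢⇒< (≤fromℕ i) λ eq →
      ℕ.1+n≢n (trans (sym πi≡1+α) (cong (toℕ ∘ (π ⟨$⟩ʳ_)) (toℕ-injective eq)))

final-letter : (c : Code n) → ∀ {e f} → Appends (perm c ⟨$⟩ʳ_) e f → Good f → ∃[ j ] letter c j ≡ e
final-letter {n} c {e} a good with toℕ e ℕ.≟ n
... | yes e≡n = zero , toℕ-injective (trans (toℕ-fromℕ n) (sym e≡n))
... | no  e≢n = suc (fromℕ< offset<width) , toℕ-injective (begin
  toℕ (letter c (suc (fromℕ< offset<width))) ≡⟨ toℕ-letter c _ ⟩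
  base c + toℕ (fromℕ< offset<width)         ≡⟨ cong (base c +_) (toℕ-fromℕ< offset<width) ⟩
  base c + (toℕ e ∸ base c)                  ≡⟨ ℕ.m+[n∸m]≡n base≤e ⟩
  toℕ e                                      ∎)
  where
  open ≡-Reasoning
  e<n : toℕ e ℕ.< n
  e<n = ℕ.≤∧≢⇒< (ℕ.≤-pred (toℕ<n e)) e≢n
  base≤e = base≤final c a good e<n
  offset<width : toℕ e ∸ base c ℕ.< width c
  offset<width = ℕ.+-cancelˡ-< (base c) _ _
    (subst (ℕ._< base c + width c) (sym (ℕ.m+[n∸m]≡n base≤e)) (final<base+width c a good e<n))

encode : (π : Permutation′ n) → Good (π ⟨$⟩ʳ_) → ∃[ c ] (perm c ⟨$⟩ʳ_) ≗ (π ⟨$⟩ʳ_)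
encode {zero}  π good = [] , λ ()
encode {suc n} π good = extend (encode (remove (fromℕ n) π) (Appends.Good⁻ appends good))
  where
  appends = remove-appends π
  extend : ∃[ c ] (perm c ⟨$⟩ʳ_) ≗ (remove (fromℕ n) π ⟨$⟩ʳ_) → ∃[ c ] (perm c ⟨$⟩ʳ_) ≗ (π ⟨$⟩ʳ_)
  extend (c , perm-c) = c ▷ j , Appends-cong (perm-appends c j) appends perm-c letter-j
    where
    -- The shortened permutation and `perm c` agree only pointwise, so the relation is rebuilt with
    -- `perm c` as its initial part.
    appends-c : Appends (perm c ⟨$⟩ʳ_) (π ⟨$⟩ʳ fromℕ n) (π ⟨$⟩ʳ_)
    appends-c = record
      { init  = λ i → trans (Appends.init appends i) (cong (punchIn _) (sym (perm-c i)))
      ; final = refl }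
    found = final-letter c appends-c good
    j = proj₁ found
    letter-j = proj₂ found

-- The cycle form

-- The relational counterpart of `successor`: `h` is the head of the whole cycle, kept fixed along
-- the list, to which the last letter returns.
data Follows (h x : A) : A → List A → Set where
  wrap  : Follows h x h (x ∷ [])
  next  : Follows h x y (x ∷ y ∷ xs)
  there : Follows h x y xs → Follows h x y (z ∷ xs)

data Step (x y : A) : List A → Set where
  step : Follows z x y (z ∷ xs) → Step x y (z ∷ xs)

Follows⇒∈ : Follows h x y xs → x ∈ xs
Follows⇒∈ wrap      = here refl
Follows⇒∈ next      = here refl
Follows⇒∈ (there s) = there (Follows⇒∈ s)

Follows⇒∈′ : Follows h x y xs → y ∈ h ∷ xs
Follows⇒∈′ wrap      = here refl
Follows⇒∈′ next      = there (there (here refl))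
Follows⇒∈′ (there s) with Follows⇒∈′ s
... | here eq = here eq
... | there i = there (there i)

Step⇒∈ : Step x y xs → x ∈ xs
Step⇒∈ (step s) = Follows⇒∈ s

Step⇒∈′ : Step x y xs → y ∈ xs
Step⇒∈′ (step s) with Follows⇒∈′ s
... | here refl = here refl
... | there i   = i

successor-outside : (h c x : Fin n) (cs : List (Fin n)) → x ∉ c ∷ cs → successor h c cs x ≡ x
successor-outside h c x [] x∉ with c ≟ x
... | yes refl = contradiction (here refl) x∉
... | no  _    = refl
successor-outside h c x (d ∷ ds) x∉ with c ≟ x
... | yes refl = contradiction (here refl) x∉
... | no  _    = successor-outside h d x ds (x∉ ∘ there)

cycle-outside : {x : Fin n} (c : List (Fin n)) → x ∉ c → cycle c x ≡ x
cycle-outside []       _  = refl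
cycle-outside (c ∷ cs) x∉ = successor-outside c c _ cs x∉

-- `successor` stops at the first occurrence of `x`, whereas `Follows` may point at any occurrence;
-- uniqueness makes them agree.
successor-follows : {h c x y : Fin n} {cs : List (Fin n)} →
  Unique (c ∷ cs) → Follows h x y (c ∷ cs) → successor h c cs x ≡ y
successor-follows {x = x} _ wrap with x ≟ x
... | yes _   = refl
... | no  x≢x = contradiction refl x≢x
successor-follows {x = x} _ next with x ≟ x
... | yes _   = refl
... | no  x≢x = contradiction refl x≢x
successor-follows {c = c} {x = x} {cs = _ ∷ _} (c∉ ∷ unique) (there s) with c ≟ x
... | yes refl = contradiction refl (All.lookup c∉ (Follows⇒∈ s))
... | no  _    = successor-follows unique s

cycle-step : {x y : Fin n} {c : List (Fin n)} → Unique c → Step x y c → cycle c x ≡ y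
cycle-step unique (step s) = successor-follows unique s

unique-++⁻ : (xs : List A) → Unique (xs ++ ys) → Unique xs × Unique ys × (∀ {x} → x ∈ xs → x ∉ ys)
unique-++⁻ []       unique         = [] , unique , λ ()
unique-++⁻ (x ∷ xs) (x∉ ∷ unique) with unique-++⁻ xs unique
... | uxs , uys , disjoint = All.++⁻ˡ xs x∉ ∷ uxs , uys , λ
  { (here refl) x∈ys → All.lookup (All.++⁻ʳ xs x∉) x∈ys refl
  ; (there x∈xs)     → disjoint x∈xs }

-- The fold of `hat` over an arbitrary list of cycles, which permits induction on that list.
product : List (List (Fin n)) → Fin n → Fin n
product = foldr (λ c f → cycle c ∘ f) id

product-outside : {x : Fin n} (cs : List (List (Fin n))) → x ∉ concat cs → product cs x ≡ x
product-outside []       _  = refl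
product-outside (c ∷ cs) x∉ = trans
  (cong (cycle c) (product-outside cs (x∉ ∘ ∈-++⁺ʳ c)))
  (cycle-outside c (x∉ ∘ ∈-++⁺ˡ))

Step⇒∈-concat : {cs : List (List A)} → Any (Step x y) cs → y ∈ concat cs
Step⇒∈-concat             (here s)  = ∈-++⁺ˡ (Step⇒∈′ s)
Step⇒∈-concat {cs = c ∷ _} (there s) = ∈-++⁺ʳ c (Step⇒∈-concat s)

-- Later cycles act first. If the step lies in the head cycle, the later ones fix `x`; if it lies
-- further on, the head cycle fixes the image `y`. Both rest on disjointness.
product-step : {x y : Fin n} (cs : List (List (Fin n))) →
  Unique (concat cs) → Any (Step x y) cs → product cs x ≡ y
product-step (c ∷ cs) unique s with unique-++⁻ c unique
product-step (c ∷ cs) unique (here s)  | uc , _ , disjoint =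
  trans (cong (cycle c) (product-outside cs (disjoint (Step⇒∈ s)))) (cycle-step uc s)
product-step (c ∷ cs) unique (there s) | _ , ucs , disjoint =
  trans (cong (cycle c) (product-step cs ucs s))
    (cycle-outside c λ y∈c → disjoint y∈c (Step⇒∈-concat s))

-- Cutting a word into blocks

cut-yes : (left : List (Fin n)) (x : Fin n) (xs : List (Fin n)) → All (_< x) left →
  let b , bs = cut (x ∷ left) xs in cut left (x ∷ xs) ≡ ([] , (x ∷ b) ∷ bs)
cut-yes left x xs all with All.all? (_<? x) left | cut (x ∷ left) xs
... | yes _    | _ = refl
... | no  ¬all | _ = contradiction all ¬all

cut-no : (left : List (Fin n)) (x : Fin n) (xs : List (Fin n)) → ¬ All (_< x) left →
  let b , bs = cut (x ∷ left) xs in cut left (x ∷ xs) ≡ (x ∷ b , bs)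
cut-no left x xs ¬all with All.all? (_<? x) left | cut (x ∷ left) xs
... | yes all | _ = contradiction all ¬all
... | no  _   | _ = refl

cut-concat : (left xs : List (Fin n)) → let b , bs = cut left xs in b ++ concat bs ≡ xs
cut-concat left []       = refl
cut-concat left (x ∷ xs) with All.all? (_<? x) left | cut (x ∷ left) xs | cut-concat (x ∷ left) xs
... | yes _ | _ | eq = cong (x ∷_) eq
... | no  _ | _ | eq = cong (x ∷_) eq

cut-[] : (xs : List (Fin n)) → proj₁ (cut [] xs) ≡ []
cut-[] []       = refl
cut-[] (x ∷ xs) = cong proj₁ (cut-yes [] x xs [])

cycles-concat : (xs : List (Fin n)) → concat (cycles xs) ≡ xs
cycles-concat xs = trans (cong (_++ concat (cycles xs)) (sym (cut-[] xs))) (cut-concat [] xs)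

-- A record of the word formed by `left` and `f` together: the form of `Record` that is stable under
-- the recursion of `cut`.
NewMax : List (Fin n) → (Fin m → Fin n) → Fin m → Set
NewMax left f q = All (_< f q) left × Record f q

NewMax-tail : {left : List (Fin n)} {f : Fin (suc m) → Fin n} {q : Fin m} →
  NewMax left f (suc q) → NewMax (f zero ∷ left) (f ∘ suc) q
NewMax-tail (all , rec) = rec z<s ∷ all , λ i<q → rec (s<s i<q)

NewMax-tail⁻ : {left : List (Fin n)} {f : Fin (suc m) → Fin n} {q : Fin m} →
  NewMax (f zero ∷ left) (f ∘ suc) q → NewMax left f (suc q)
NewMax-tail⁻ (f₀< ∷ all , rec) = all , λ
  { {zero}  _         → f₀<
  ; {suc i} (s<s i<q) → rec i<q }

-- No cut separates the two letters. If they fall into the initial part, the head of their block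
-- lies in `left` and is not visible yet, hence the quantification over `h`; the nearest cut to the
-- left supplies it.
cut-adjacent : (left : List (Fin n)) (f : Fin m → Fin n) {p q : Fin m} →
  toℕ q ≡ suc (toℕ p) → ¬ NewMax left f q →
  let b , bs = cut left (tabulate f) in
  (∀ h → Follows h (f p) (f q) b) ⊎ Any (Step (f p) (f q)) bs
cut-adjacent left f {zero} {suc zero} refl ¬max
  rewrite cut-no (f zero ∷ left) (f (suc zero)) (tabulate (λ i → f (suc (suc i))))
    (λ all → ¬max (NewMax-tail⁻ {f = f} (all , λ ())))
  with All.all? (_<? f zero) left
... | yes _ = inj₂ (here (step next))
... | no  _ = inj₁ λ _ → next
cut-adjacent left f {suc p} {suc q} q≡1+p ¬max
  with All.all? (_<? f zero) left | cut (f zero ∷ left) (tabulate (f ∘ suc))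
     | cut-adjacent (f zero ∷ left) (f ∘ suc) (ℕ.suc-injective q≡1+p) (¬max ∘ NewMax-tail⁻ {f = f})
... | yes _ | _ | inj₁ s = inj₂ (here (step (there (s _))))
... | no  _ | _ | inj₁ s = inj₁ (there ∘ s)
... | yes _ | _ | inj₂ s = inj₂ (there s)
... | no  _ | _ | inj₂ s = inj₂ s

-- Quantifying over `q` with `toℕ q ≡ 0` treats the empty word together with a word that opens with
-- a new maximum.
cut-at-max : (left : List (Fin n)) (f : Fin m → Fin n) →
  (∀ q → toℕ q ≡ 0 → NewMax left f q) → proj₁ (cut left (tabulate f)) ≡ []
cut-at-max {m = zero}  left f max = refl
cut-at-max {m = suc _} left f max =
  cong proj₁ (cut-yes left (f zero) (tabulate (f ∘ suc)) (proj₁ (max zero refl)))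

-- `M` is the letter that opened the current block. It prevents any cut up to `p`, so the initial
-- part ends exactly at `p` and wraps around to whatever head `h` is prescribed.
cut-last : (left : List (Fin n)) (f : Fin m → Fin n) {M : Fin n} {p : Fin m} → M ∈ left →
  (∀ {i} → i ≤ p → f i < M) → (∀ q → toℕ q ≡ suc (toℕ p) → NewMax left f q) →
  Follows h (f p) h (proj₁ (cut left (tabulate f)))
cut-last left f {p = zero} M∈ <M max
  rewrite cut-no left (f zero) (tabulate (f ∘ suc)) (λ all → ℕ.<-asym (All.lookup all M∈) (<M z≤n))
        | cut-at-max (f zero ∷ left) (f ∘ suc) (λ q q≡0 → NewMax-tail {f = f} (max (suc q) (cong suc q≡0)))
  = wrap
cut-last left f {p = suc p} M∈ <M max
  rewrite cut-no left (f zero) (tabulate (f ∘ suc)) (λ all → ℕ.<-asym (All.lookup all M∈) (<M z≤n))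
  = there (cut-last (f zero ∷ left) (f ∘ suc) (there M∈) (<M ∘ s≤s)
      (λ q q≡1+p → NewMax-tail {f = f} (max (suc q) (cong suc q≡1+p))))

-- The block opened at `j` closes at `p`: the letters in between stay below `f j`, and after `p`
-- comes a new maximum or the end of the word.
cut-wrap : (left : List (Fin n)) (f : Fin m → Fin n) {j p : Fin m} → j ≤ p →
  NewMax left f j → (∀ {i} → j < i → i ≤ p → f i < f j) →
  (∀ q → toℕ q ≡ suc (toℕ p) → NewMax left f q) →
  Any (Step (f p) (f j)) (proj₂ (cut left (tabulate f)))
cut-wrap left f {zero} {zero} _ (all , _) _ max
  rewrite cut-yes left (f zero) (tabulate (f ∘ suc)) all
        | cut-at-max (f zero ∷ left) (f ∘ suc) (λ q q≡0 → NewMax-tail {f = f} (max (suc q) (cong suc q≡0)))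
  = here (step wrap)
cut-wrap left f {zero} {suc p} _ (all , _) <fj max
  rewrite cut-yes left (f zero) (tabulate (f ∘ suc)) all
  = here (step (there (cut-last (f zero ∷ left) (f ∘ suc) (here refl) (λ i≤p → <fj z<s (s≤s i≤p))
      (λ q q≡1+p → NewMax-tail {f = f} (max (suc q) (cong suc q≡1+p))))))
cut-wrap left f {suc j} {suc p} (s≤s j≤p) maxj <fj max
  with All.all? (_<? f zero) left | cut (f zero ∷ left) (tabulate (f ∘ suc))
     | cut-wrap (f zero ∷ left) (f ∘ suc) j≤p (NewMax-tail {f = f} maxj) (λ j<i i≤p → <fj (s<s j<i) (s≤s i≤p))
         (λ q q≡1+p → NewMax-tail {f = f} (max (suc q) (cong suc q≡1+p)))
... | yes _ | _ | s = there s
... | no  _ | _ | s = s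

-- Arrows of the cycle form

⟨$⟩ʳ-injective : (π : Permutation′ n) {i j : Fin n} → π ⟨$⟩ʳ i ≡ π ⟨$⟩ʳ j → i ≡ j
⟨$⟩ʳ-injective π eq = trans (sym (inverseˡ π)) (trans (cong (π ⟨$⟩ˡ_) eq) (inverseˡ π))

hat-step : (π : Permutation′ n) {x y : Fin n} → Any (Step x y) (cycles (word π)) → hat π x ≡ y
hat-step π = product-step (cycles (word π))
  (subst Unique (sym (cycles-concat (word π))) (tabulate⁺ (⟨$⟩ʳ-injective π)))

hat-ascent : (π : Permutation′ n) {p q : Fin n} → toℕ q ≡ suc (toℕ p) →
  ¬ Record (π ⟨$⟩ʳ_) q → hat π (π ⟨$⟩ʳ p) ≡ π ⟨$⟩ʳ q
hat-ascent π {p} q≡1+p ¬rec with cut-adjacent [] (π ⟨$⟩ʳ_) q≡1+p (¬rec ∘ proj₂)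
... | inj₂ s = hat-step π s
... | inj₁ s with subst (Follows _ _ _) (cut-[] (word π)) (s (π ⟨$⟩ʳ p))
... | ()

Record? : (f : Fin m → Fin n) (j : Fin m) → Dec (Record f j)
Record? f j = map′ (λ rec {i} → rec i) (λ rec i → rec {i})
  (all? λ i → (i <? j) →-dec (f i <? f j))

-- The maximum of the prefix up to `p` is its latest record, so `j` is where the block containing
-- `p` starts.
Dominates : (Fin m → Fin n) → Fin m → Fin m → Set
Dominates f j p = j ≤ p × (∀ {i} → i ≤ p → i ≢ j → f i < f j)

dominates⇒record : {f : Fin m → Fin n} {j p : Fin m} → Dominates f j p → Record f j
dominates⇒record (j≤p , <fj) i<j = <fj (ℕ.<⇒≤ (ℕ.<-≤-trans i<j j≤p)) (Fin.<⇒≢ i<j)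

prefix-maximum : (f : Fin m → Fin n) → (∀ {i j} → f i ≡ f j → i ≡ j) → ∀ p → ∃[ j ] Dominates f j p
prefix-maximum f inj zero = zero , z≤n , λ { {zero} _ i≢0 → contradiction refl i≢0 }
prefix-maximum f inj (suc p) with prefix-maximum (f ∘ suc) (suc-injective ∘ inj) p
... | j , j≤p , <fj with <-cmp (f zero) (f (suc j))
... | tri≈ _ eq _ = contradiction (inj eq) λ ()
... | tri< f₀<fj _ _ = suc j , s≤s j≤p , λ
  { {zero}  _         _     → f₀<fj
  ; {suc i} (s≤s i≤p) i≢j → <fj i≤p (i≢j ∘ cong suc) }
... | tri> _ _ fj<f₀ = zero , z≤n , λ
  { {zero}  _         0≢0 → contradiction refl 0≢0
  ; {suc i} (s≤s i≤p) _   → below i≤p }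
  where
  below : ∀ {i} → i ≤ p → f (suc i) < f zero
  below {i} i≤p with i ≟ j
  ... | yes refl = fj<f₀
  ... | no  i≢j  = ℕ.<-trans (<fj i≤p i≢j) fj<f₀

hat-block-end : (π : Permutation′ n) {j p : Fin n} → Dominates (π ⟨$⟩ʳ_) j p →
  (∀ q → toℕ q ≡ suc (toℕ p) → Record (π ⟨$⟩ʳ_) q) → hat π (π ⟨$⟩ʳ p) ≡ π ⟨$⟩ʳ j
hat-block-end π d@(j≤p , <πj) rec = hat-step π
  (cut-wrap [] (π ⟨$⟩ʳ_) j≤p ([] , dominates⇒record d)
    (λ j<i i≤p → <πj i≤p (Fin.<⇒≢ j<i ∘ sym))
    (λ q q≡1+p → [] , rec q q≡1+p))

-- Either the next letter continues the block of `p`, or the block ends at `p` and the arrow returns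
-- to its head. Deciding the first alternative covers both ways of ending, by a record and by the
-- end of the word.
hat-cases : (π : Permutation′ n) (p : Fin n) →
  (∃[ q ] toℕ q ≡ suc (toℕ p) × ¬ Record (π ⟨$⟩ʳ_) q × hat π (π ⟨$⟩ʳ p) ≡ π ⟨$⟩ʳ q) ⊎
  (∃[ j ] Dominates (π ⟨$⟩ʳ_) j p × hat π (π ⟨$⟩ʳ p) ≡ π ⟨$⟩ʳ j)
hat-cases {n} π p
  with any? (λ q → (toℕ q ℕ.≟ suc (toℕ p)) ×-dec ¬? (Record? (π ⟨$⟩ʳ_) q))
... | yes (q , q≡1+p , ¬rec) = inj₁ (q , q≡1+p , ¬rec , hat-ascent π q≡1+p ¬rec)
... | no  none = let j , d = prefix-maximum (π ⟨$⟩ʳ_) (⟨$⟩ʳ-injective π) p in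
  inj₂ (j , d , hat-block-end π d λ q q≡1+p →
    decidable-stable (Record? (π ⟨$⟩ʳ_) q) λ ¬rec → none (q , q≡1+p , ¬rec))

-- Avoidance of the arrow pattern

contains : (π : Permutation′ n) {a : Fin n} {i k : Fin n} → i < k → a < π ⟨$⟩ʳ i →
  π ⟨$⟩ʳ i < π ⟨$⟩ʳ k → hat π a ≡ π ⟨$⟩ʳ k → Contains π pattern-23-1→3
contains π {a} {i} {k} i<k a<πi πi<πk hat-a =
  (λ { 0F → a ; 1F → π ⟨$⟩ʳ i ; 2F → π ⟨$⟩ʳ k }) ,
  (λ { 0F → i ; 1F → k }) ,
  (λ { {0F} {1F} _ → a<πi
     ; {0F} {2F} _ → ℕ.<-trans a<πi πi<πk
     ; {1F} {2F} _ → πi<πk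
     ; {1F} {1F} 1<1 → contradiction 1<1 (ℕ.<-irrefl refl)
     ; {2F} {1F} (s<s ())
     ; {2F} {2F} 2<2 → contradiction 2<2 (ℕ.<-irrefl refl) }) ,
  (λ { {0F} {1F} _ → i<k
     ; {1F} {1F} 1<1 → contradiction 1<1 (ℕ.<-irrefl refl) }) ,
  (λ { 0F → refl ; 1F → refl }) ,
  hat-a ∷ []

-- From k on, follow the word until it rises above π i again or the block ends:
-- either way the arrow starting there jumps over π i.
block-violation : (π : Permutation′ n) {i j k : Fin n} → Acc _>_ k → i < j → j ≤ k →
  Record (π ⟨$⟩ʳ_) j → π ⟨$⟩ʳ k < π ⟨$⟩ʳ i → Contains π pattern-23-1→3
block-violation π {i} {j} {k} (acc rs) i<j j≤k rec πk<πi with hat-cases π k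
... | inj₂ (l , (l≤k , <πl) , hat-k) = contains π i<l πk<πi πi<πl hat-k
  where
  πj≤πl : π ⟨$⟩ʳ j ≤ π ⟨$⟩ʳ l
  πj≤πl with j ≟ l
  ... | yes refl = ℕ.≤-refl
  ... | no  j≢l  = ℕ.<⇒≤ (<πl j≤k j≢l)
  -- If `l` came before `j`, the record at `j` would exceed the prefix maximum at `l`.
  i<l : i < l
  i<l = ℕ.<-≤-trans i<j (ℕ.≮⇒≥ λ l<j → ℕ.<⇒≱ (rec l<j) πj≤πl)
  πi<πl : π ⟨$⟩ʳ i < π ⟨$⟩ʳ l
  πi<πl = ℕ.<-≤-trans (rec i<j) πj≤πl
... | inj₁ (q , q≡1+k , _ , hat-k) with <-cmp (π ⟨$⟩ʳ i) (π ⟨$⟩ʳ q)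
... | tri< πi<πq _ _ = contains π (ℕ.<-trans (ℕ.<-≤-trans i<j j≤k) (ℕ.≤-reflexive (sym q≡1+k))) πk<πi πi<πq hat-k
... | tri≈ _ eq _ = contradiction (cong toℕ (⟨$⟩ʳ-injective π eq))
  (ℕ.<⇒≢ (ℕ.<-trans (ℕ.<-≤-trans i<j j≤k) (ℕ.≤-reflexive (sym q≡1+k))))
... | tri> _ _ πq<πi = block-violation π (rs (ℕ.≤-reflexive (sym q≡1+k))) i<j
  (ℕ.≤-trans j≤k (ℕ.<⇒≤ (ℕ.≤-reflexive (sym q≡1+k)))) rec πq<πi

-- A failure of `blocks` is a descent below `π i` across a record, from which `block-violation`
-- extracts an occurrence. A failure of `ascents` is itself an arrow from `π j` to `π k` jumping
-- over `π i`.
avoids⇒good : (π : Permutation′ n) → Avoids π pattern-23-1→3 → Good (π ⟨$⟩ʳ_)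
avoids⇒good π avoids .blocks {i} {j} {k} i<j j<k rec with <-cmp (π ⟨$⟩ʳ i) (π ⟨$⟩ʳ k)
... | tri< πi<πk _ _ = πi<πk
... | tri≈ _ eq _    = contradiction (⟨$⟩ʳ-injective π eq) (Fin.<⇒≢ (ℕ.<-trans i<j j<k))
... | tri> _ _ πk<πi = contradiction
  (block-violation π (>-wellFounded k) i<j (ℕ.<⇒≤ j<k) rec πk<πi) avoids
avoids⇒good π avoids .ascents {i} {j} {k} i<j k≡1+j πj<πi πi<πk =
  decidable-stable (Record? (π ⟨$⟩ʳ_) k) λ ¬rec →
    avoids (contains π (ℕ.<-trans i<j (ℕ.≤-reflexive (sym k≡1+j))) πj<πi πi<πk (hat-ascent π k≡1+j ¬rec))

-- If the arrow leads to the next letter of the block, `i` lies before `p` and `ascents` forbids the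
-- jump. If it returns to the head of the block, then `k` is a record with `i < k < p`, and `blocks`
-- forces `π i < π p`.
arrow-impossible : (π : Permutation′ n) → Good (π ⟨$⟩ʳ_) → {p i k : Fin n} → i < k →
  π ⟨$⟩ʳ p < π ⟨$⟩ʳ i → π ⟨$⟩ʳ i < π ⟨$⟩ʳ k → hat π (π ⟨$⟩ʳ p) ≢ π ⟨$⟩ʳ k
arrow-impossible π good {p} {i} {k} i<k πp<πi πi<πk hat-p with hat-cases π p
... | inj₁ (q , q≡1+p , ¬rec , hat-p′) with ⟨$⟩ʳ-injective π (trans (sym hat-p′) hat-p)
... | refl = ¬rec (ascents good i<p q≡1+p πp<πi πi<πk)
  where
  i<p : i < p
  i<p = Fin.≤∧≢⇒< (ℕ.≤-pred (subst (toℕ i ℕ.<_) q≡1+p i<k))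
    λ i≡p → Fin.<⇒≢ πp<πi (cong (π ⟨$⟩ʳ_) (sym i≡p))
arrow-impossible π good {p} {i} {k} i<k πp<πi πi<πk hat-p
  | inj₂ (j , d@(j≤p , _) , hat-p′) with ⟨$⟩ʳ-injective π (trans (sym hat-p′) hat-p)
... | refl = ℕ.<-asym πp<πi (blocks good i<k j<p (dominates⇒record d))
  where
  j<p : j < p
  j<p = Fin.≤∧≢⇒< j≤p λ j≡p → Fin.<⇒≢ (ℕ.<-trans πp<πi πi<πk) (cong (π ⟨$⟩ʳ_) (sym j≡p))

good⇒avoids : (π : Permutation′ n) → Good (π ⟨$⟩ʳ_) → Avoids π pattern-23-1→3
good⇒avoids π good (x , t , x-mono , t-mono , word-eq , hat-x ∷ []) =
  arrow-impossible π good {p = π ⟨$⟩ˡ x 0F} (t-mono z<s)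
    (subst₂ _<_ (sym (inverseʳ π)) (sym (word-eq 0F)) (x-mono z<s))
    (subst₂ _<_ (sym (word-eq 0F)) (sym (word-eq 1F)) (x-mono (s<s z<s)))
    (trans (cong (hat π) (inverseʳ π)) (trans hat-x (sym (word-eq 1F))))

-- The code is extracted from evidence of avoidance; `perm-injective` shows that it depends only on
-- the word, which gives `to-cong` and one of the inverse laws.
𝒮↔Code : ∀ n → Inverse (𝒮 n pattern-23-1→3) (setoid (Code n))
𝒮↔Code n = record
  { to        = to
  ; from      = from
  ; to-cong   = λ {a} {b} a≈b → perm-injective (to a) (to b) λ i →
      trans (perm-to a i) (trans (a≈b i) (sym (perm-to b i)))
  ; from-cong = λ { refl _ → refl }
  ; inverse   =
      (λ {c} {a} a≈c → perm-injective (to a) c λ i → trans (perm-to a i) (a≈c i)) ,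
      (λ { {a} refl → perm-to a })
  }
  where
  to : ∃[ π ] Avoids π pattern-23-1→3 → Code n
  to (π , avoids) = proj₁ (encode π (avoids⇒good π avoids))
  perm-to : ∀ a → (perm (to a) ⟨$⟩ʳ_) ≗ (proj₁ a ⟨$⟩ʳ_)
  perm-to (π , avoids) = proj₂ (encode π (avoids⇒good π avoids))
  from : Code n → ∃[ π ] Avoids π pattern-23-1→3
  from c = perm c , good⇒avoids (perm c) (perm-good c)

theorem5p4 : (n : ℕ) → n ≥ 1 → Inverse (𝒮 n pattern-23-1→3) (setoid (Fin (catalan n)))
theorem5p4 n _ = inverse (𝒮↔Code n) (Code↔Fin-catalan n)
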